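{- Let $P:=R_1\cup\ldots\cup R_n$ be a well-moded general logic program such that $R_n\sqsupset\ldots\sqsupset R_1$ is a hierarchy, and let $|\ |_1,\ldots,|\ |_n$ be moded level mappings for $R_1,\ldots,R_n$, respectively. Then every well-moded query is strongly bounded with respect to $P$ and $|\ |_1,\ldots,|\ |_n$.
   Context: **Programs.** All programs and queries are over a fixed first-order language with at least one constant. A literal is an atom or a negated atom. A (general) clause is $H\leftarrow L_1,\ldots,L_n$ ($n\ge 0$), $H$ an atom, $L_i$ literals. A (general) query is a finite, possibly empty, sequence of literals. A (general) program is a finite set of clauses. $\mathit{rel}(L)$ is the predicate symbol of $L$. $B_P$ is the set of ground atoms whose predicate symbol occurs in $P$. **LDNF-resolution (leftmost selection rule).** For a program $P$ and a non-empty query $Q=L,\mathbf{L}$: (i) if $L=A$ is an atom, the resolvents of $Q$ are the queries $(\mathbf{B},\mathbf{L})\theta$ for $H\leftarrow\mathbf{B}$ a variant of a clause of $P$ renamed apart from $Q$ and $\theta=\mathrm{mgu}(A,H)$; (ii) if $L=\neg A$ with $A$ ground, a subsidiary LDNF-tree for $P\cup\{A\}$ is constructed; if this tree is finite and finitely failed, $Q$ has the single resolvent $\mathbf{L}$; if it is finite and has a successful branch, $Q$ fails; if its construction diverges, the derivation containing $Q$ is considered infinite; (iii) if $L=\neg A$ with $A$ non-ground, the derivation flounders: it ends with no resolvent. A branch is successful if it ends in the empty query; it is failed if it ends in a query whose first literal is positive with no resolvent, or negative and ground with a finite subsidiary tree having a successful branch. A tree is finitely failed if it is finite and all its branches are failed.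 The LDNF-descendants of $P\cup\{Q\}$ are all queries occurring during LDNF-resolution of $P\cup\{Q\}$, including $Q$ itself and all queries occurring in the construction of all (nested) subsidiary LDNF-trees (including their roots). $\mathit{first}(Q)$ is the first literal of a non-empty query, and $\mathit{Call}_P(Q)=\{\mathit{first}(Q') : Q' \text{ a (non-empty) LDNF-descendant of } P\cup\{Q\}\}$. **Modes.** A mode for an $n$-ary predicate $p$ is a function $m_p:\{1,\ldots,n\}\to\{+,-\}$; $i$ is an input position if $m_p(i)=+$ and an output position if $m_p(i)=-$. Every predicate symbol has a fixed unique mode. A literal (positive or negative) is written $p(\mathbf{s},\mathbf{t})$ with $\mathbf{s}$ the terms in the input positions and $\mathbf{t}$ those in the output positions. A query $p_1(\mathbf{s}_1,\mathbf{t}_1),\ldots,p_n(\mathbf{s}_n,\mathbf{t}_n)$ is well-moded if $\mathit{Var}(\mathbf{s}_i)\subseteq\bigcup_{j=1}^{i-1}\mathit{Var}(\mathbf{t}_j)$ for all $i\in\{1,\ldots,n\}$. A clause $p(\mathbf{t}_0,\mathbf{s}_{n+1})\leftarrow p_1(\mathbf{s}_1,\mathbf{t}_1),\ldots,p_n(\mathbf{s}_n,\mathbf{t}_n)$ (where $\mathbf{t}_0$ are the input terms and $\mathbf{s}_{n+1}$ the output terms of the head) is well-moded if $\mathit{Var}(\mathbf{s}_i)\subseteq\bigcup_{j=0}^{i-1}\mathit{Var}(\mathbf{t}_j)$ for all $i\in\{1,\ldots,n+1\}$. A program is well-moded if all its clauses are. **Level mappings, boundedness.** A level mapping for $P$ is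 a function $|\ |:B_P\to\mathbf{N}$, extended to ground literals by $|\neg A|=|A|$. It is a moded level mapping if $|p(\mathbf{s},\mathbf{t})|=|p(\mathbf{s},\mathbf{u})|$ for all $p$ and all (ground) $\mathbf{s},\mathbf{t},\mathbf{u}$. An atom $A$ is bounded w.r.t. $|\ |$ if $\{|A'| : A' \text{ a ground instance of } A\}$ is finite. **Hierarchy.** A relation is defined in $P$ if it occurs in the head of a clause of $P$; a literal $L$ is defined in $P$ if $\mathit{rel}(L)$ is. $P$ extends $R$, written $P\sqsupset R$, if no relation defined in $P$ occurs in $R$. $R_n\sqsupset\cdots\sqsupset R_1$ is a hierarchy if $R_{i+1}\sqsupset(R_1\cup\cdots\cup R_i)$ for all $i\in\{1,\ldots,n-1\}$. **Strong boundedness.** For such a hierarchy with $P=R_1\cup\ldots\cup R_n$ and level mappings $|\ |_i$ for $R_i$, a query $Q$ is strongly bounded w.r.t. $P$ and $|\ |_1,\ldots,|\ |_n$ if for all atoms $A\in\mathit{Call}_P(Q)$ and all $i\in\{1,\ldots,n\}$, if $A$ is defined in $R_i$ then $A$ is bounded w.r.t. $|\ |_i$. -}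

module Defs where

open import Data.Empty using (⊥)
open import Data.Fin using (Fin; toℕ)
open import Data.List using (List; []; _∷_; [_]; _++_; map; concat; concatMap; filter; take; tabulate; allFin; length; lookup)
open import Data.List.Membership.Propositional using (_∈_)
open import Data.List.Relation.Binary.Disjoint.Propositional using (Disjoint)
open import Data.List.Relation.Binary.Subset.Propositional using (_⊆_)
open import Data.List.Relation.Unary.All using (All)
open import Data.List.Relation.Unary.Any using (Any)
open import Data.Nat using (ℕ; _≟_)
open import Data.Product using (_×_; _,_; ∃; ∃₂; ∃-syntax)
open import Data.Sum using (_⊎_)
open import Data.Unit using (⊤)
open import Data.Vec as Vec using (Vec; []; _∷_)
open import Function using (_⇔_)
open import Relation.Binary using (DecidableEquality)
open import Relation.Binary.PropositionalEquality using (_≡_; refl)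
open import Relation.Nullary using (¬_; yes; no)

record Language : Set₁ where
  field
    FunSym         : Set
    funArity       : FunSym → ℕ
    RelSym         : Set
    relArity       : RelSym → ℕ
    constant       : FunSym
    constant-arity : funArity constant ≡ 0

data Mode : Set where
  input output : Mode

_≟ᵐ_ : DecidableEquality Mode
input  ≟ᵐ input  = yes refl
input  ≟ᵐ output = no λ ()
output ≟ᵐ input  = no λ ()
output ≟ᵐ output = yes refl

Finite : (ℕ → Set) → Set
Finite S = ∃[ ks ] (∀ k → S k ⇔ k ∈ ks)

module LogicPrograms (𝓛 : Language) where
  open Language 𝓛

  Var : Set
  Var = ℕ

  data Term : Set where
    var : Var → Term
    fun : (f : FunSym) → Vec Term (funArity f) → Term

  record Atom : Set where
    constructor atom
    field
      rel  : RelSym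
      args : Vec Term (relArity rel)

  data Literal : Set where
    pos neg : Atom → Literal

  Query : Set
  Query = List Literal

  infix 4 _←_
  record Clause : Set where
    constructor _←_
    field
      head : Atom
      body : Query

  -- A finite set of clauses; only membership in the list is ever used.
  Program : Set
  Program = List Clause

  atomOf : Literal → Atom
  atomOf (pos A) = A
  atomOf (neg A) = A

  relOf : Literal → RelSym
  relOf L = Atom.rel (atomOf L)

  varsᵗ  : Term → List Var
  varsᵗˢ : ∀ {n} → Vec Term n → List Var
  varsᵗ (var x)    = [ x ]
  varsᵗ (fun f ts) = varsᵗˢ ts
  varsᵗˢ []        = []
  varsᵗˢ (t ∷ ts)  = varsᵗ t ++ varsᵗˢ ts

  varsᵃ : Atom → List Var
  varsᵃ A = varsᵗˢ (Atom.args A)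

  varsᵠ : Query → List Var
  varsᵠ = concatMap (λ L → varsᵃ (atomOf L))

  varsᶜ : Clause → List Var
  varsᶜ (H ← B) = varsᵃ H ++ varsᵠ B

  Ground : Atom → Set
  Ground A = varsᵃ A ≡ []

  -- A finite set of bindings x / t. The first binding for a variable is
  -- the one that counts; an unbound variable is left unchanged.
  Subst : Set
  Subst = List (Var × Term)

  _⟨_⟩ : Subst → Var → Term
  [] ⟨ x ⟩            = var x
  ((y , t) ∷ θ) ⟨ x ⟩ with x ≟ y
  ... | yes _ = t
  ... | no  _ = θ ⟨ x ⟩

  infixl 8 _[_]ᵗ _[_]ᵗˢ _[_]ᵃ _[_]ˡ _[_]ᵠ _[_]ᶜ

  _[_]ᵗ  : Term → Subst → Term
  _[_]ᵗˢ : ∀ {n} → Vec Term n → Subst → Vec Term n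
  var x    [ θ ]ᵗ  = θ ⟨ x ⟩
  fun f ts [ θ ]ᵗ  = fun f (ts [ θ ]ᵗˢ)
  []       [ θ ]ᵗˢ = []
  (t ∷ ts) [ θ ]ᵗˢ = (t [ θ ]ᵗ) ∷ (ts [ θ ]ᵗˢ)

  _[_]ᵃ : Atom → Subst → Atom
  atom p ts [ θ ]ᵃ = atom p (ts [ θ ]ᵗˢ)

  _[_]ˡ : Literal → Subst → Literal
  pos A [ θ ]ˡ = pos (A [ θ ]ᵃ)
  neg A [ θ ]ˡ = neg (A [ θ ]ᵃ)

  _[_]ᵠ : Query → Subst → Query
  Q [ θ ]ᵠ = map (_[ θ ]ˡ) Q

  _[_]ᶜ : Clause → Subst → Clause
  (H ← B) [ θ ]ᶜ = (H [ θ ]ᵃ) ← (B [ θ ]ᵠ)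

  _InstanceOf_ : Atom → Atom → Set
  A′ InstanceOf A = ∃[ θ ] A′ ≡ A [ θ ]ᵃ

  _VariantOf_ : Clause → Clause → Set
  c′ VariantOf c = (∃[ θ ] c′ ≡ c [ θ ]ᶜ) × (∃[ θ ] c ≡ c′ [ θ ]ᶜ)

  Unifies : Subst → Atom → Atom → Set
  Unifies θ A H = A [ θ ]ᵃ ≡ H [ θ ]ᵃ

  IsMGU : Subst → Atom → Atom → Set
  IsMGU θ A H =
    Unifies θ A H ×
    (∀ σ → Unifies σ A H → ∃[ γ ] (∀ x → σ ⟨ x ⟩ ≡ θ ⟨ x ⟩ [ γ ]ᵗ))

  -- Q′ is a resolvent, via the program clause c, of the query pos A ∷ 𝐋.
  data ResolventVia (c : Clause) (A : Atom) (𝐋 : Query) : Query → Set where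
    resolvent : ∀ H B θ → (H ← B) VariantOf c →
                Disjoint (varsᶜ (H ← B)) (varsᵠ (pos A ∷ 𝐋)) →
                IsMGU θ A H →
                ResolventVia c A 𝐋 ((B ++ 𝐋) [ θ ]ᵠ)

  module _ (P : Program) where

    -- LDNFTree Q is the type of finite LDNF-trees for P ∪ {Q}. As the trees
    -- are well-founded, a query whose first literal has a diverging
    -- subsidiary tree has no LDNFTree. At a positive literal, a tree fixes
    -- one renamed-apart variant and one mgu for each applicable clause.
    data LDNFTree : Query → Set
    data ClauseBranch (c : Clause) (A : Atom) (𝐋 : Query) : Set
    FinitelyFailed      : ∀ {Q} → LDNFTree Q → Set
    FailedVia           : ∀ {c A 𝐋} → ClauseBranch c A 𝐋 → Set
    HasSuccessfulBranch : ∀ {Q} → LDNFTree Q → Set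
    SuccessfulVia       : ∀ {c A 𝐋} → ClauseBranch c A 𝐋 → Set

    data LDNFTree where
      success : LDNFTree []
      resolve : ∀ {A 𝐋} → (∀ c → c ∈ P → ClauseBranch c A 𝐋) →
                LDNFTree (pos A ∷ 𝐋)
      neg-resolve : ∀ {A 𝐋} → Ground A →
                    (S : LDNFTree [ pos A ]) → FinitelyFailed S →
                    LDNFTree 𝐋 → LDNFTree (neg A ∷ 𝐋)
      neg-fail : ∀ {A 𝐋} → Ground A →
                 (S : LDNFTree [ pos A ]) → HasSuccessfulBranch S →
                 LDNFTree (neg A ∷ 𝐋)
      -- The subsidiary tree is finite but, owing to floundering, neither
      -- finitely failed nor successful. Then there is no resolvent, but the
      -- branch does not count as failed either.
      neg-inconclusive : ∀ {A 𝐋} → Ground A →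
                         (S : LDNFTree [ pos A ]) →
                         ¬ FinitelyFailed S → ¬ HasSuccessfulBranch S →
                         LDNFTree (neg A ∷ 𝐋)
      flounder : ∀ {A 𝐋} → ¬ Ground A → LDNFTree (neg A ∷ 𝐋)

    data ClauseBranch c A 𝐋 where
      inapplicable : (∀ Q′ → ¬ ResolventVia c A 𝐋 Q′) → ClauseBranch c A 𝐋
      child        : ∀ {Q′} → ResolventVia c A 𝐋 Q′ → LDNFTree Q′ →
                     ClauseBranch c A 𝐋

    FinitelyFailed success                    = ⊥
    FinitelyFailed (resolve bs)               = ∀ c (c∈P : c ∈ P) → FailedVia (bs c c∈P)
    FinitelyFailed (neg-resolve _ _ _ T)      = FinitelyFailed T
    FinitelyFailed (neg-fail _ _ _)           = ⊤
    FinitelyFailed (neg-inconclusive _ _ _ _) = ⊥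
    FinitelyFailed (flounder _)               = ⊥

    FailedVia (inapplicable _) = ⊤
    FailedVia (child _ T)      = FinitelyFailed T

    HasSuccessfulBranch success                    = ⊤
    HasSuccessfulBranch (resolve bs)               = ∃₂ λ c (c∈P : c ∈ P) → SuccessfulVia (bs c c∈P)
    HasSuccessfulBranch (neg-resolve _ _ _ T)      = HasSuccessfulBranch T
    HasSuccessfulBranch (neg-fail _ _ _)           = ⊥
    HasSuccessfulBranch (neg-inconclusive _ _ _ _) = ⊥
    HasSuccessfulBranch (flounder _)               = ⊥

    SuccessfulVia (inapplicable _) = ⊥
    SuccessfulVia (child _ T)      = HasSuccessfulBranch T

    data Resolvent : Query → Query → Set where
      pos : ∀ {c A 𝐋 Q′} → c ∈ P → ResolventVia c A 𝐋 Q′ →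
            Resolvent (pos A ∷ 𝐋) Q′
      neg : ∀ {A 𝐋} → Ground A →
            (S : LDNFTree [ pos A ]) → FinitelyFailed S →
            Resolvent (neg A ∷ 𝐋) 𝐋

    -- Descendant Q Q′: Q′ is an LDNF-descendant of P ∪ {Q}. The root of a
    -- subsidiary tree is a descendant whether or not that tree is finite.
    data Descendant : Query → Query → Set where
      root       : ∀ {Q} → Descendant Q Q
      step       : ∀ {Q Q′ Q″} → Resolvent Q Q′ → Descendant Q′ Q″ →
                   Descendant Q Q″
      subsidiary : ∀ {A 𝐋 Q″} → Ground A → Descendant [ pos A ] Q″ →
                   Descendant (neg A ∷ 𝐋) Q″

    Call : Query → Literal → Set
    Call Q L = ∃[ 𝐋 ] Descendant Q (L ∷ 𝐋)

  Moding : Set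
  Moding = (p : RelSym) → Fin (relArity p) → Mode

  module _ (mode : Moding) where

    termsAt : Mode → Atom → List Term
    termsAt d (atom p ts) =
      map (Vec.lookup ts) (filter (λ i → mode p i ≟ᵐ d) (allFin (relArity p)))

    inputs outputs : Atom → List Term
    inputs  = termsAt input
    outputs = termsAt output

    inVars outVars : Atom → List Var
    inVars  A = concatMap varsᵗ (inputs A)
    outVars A = concatMap varsᵗ (outputs A)

    outVarsᵠ : Query → List Var
    outVarsᵠ = concatMap (λ L → outVars (atomOf L))

    WellModedQuery : Query → Set
    WellModedQuery Q = ∀ (i : Fin (length Q)) →
      inVars (atomOf (lookup Q i)) ⊆ outVarsᵠ (take (toℕ i) Q)

    -- The head contributes its input variables at position 0 and has its
    -- output variables checked at position n + 1.
    WellModedClause : Clause → Set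
    WellModedClause (H ← B) =
      (∀ (i : Fin (length B)) →
        inVars (atomOf (lookup B i)) ⊆ inVars H ++ outVarsᵠ (take (toℕ i) B)) ×
      outVars H ⊆ inVars H ++ outVarsᵠ B

    WellModedProgram : Program → Set
    WellModedProgram = All WellModedClause

  DefinedIn : RelSym → Program → Set
  DefinedIn p P = Any (λ c → p ≡ Atom.rel (Clause.head c)) P

  OccursInClause : RelSym → Clause → Set
  OccursInClause p (H ← B) = p ≡ Atom.rel H ⊎ Any (λ L → p ≡ relOf L) B

  OccursIn : RelSym → Program → Set
  OccursIn p P = Any (OccursInClause p) P

  -- The set B_P. The proofs are irrelevant, so that an element is
  -- determined by its atom.
  record GroundAtom (P : Program) : Set where
    constructor groundAtom
    field
      atomᵍ   : Atom
      .ground : Ground atomᵍ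
      .occurs : OccursIn (Atom.rel atomᵍ) P
  open GroundAtom public using (atomᵍ)

  LevelMapping : Program → Set
  LevelMapping P = GroundAtom P → ℕ

  Moded : Moding → ∀ {P} → LevelMapping P → Set
  Moded mode {P} ∣_∣ = ∀ (A B : GroundAtom P) →
    Atom.rel (atomᵍ A) ≡ Atom.rel (atomᵍ B) →
    inputs mode (atomᵍ A) ≡ inputs mode (atomᵍ B) →
    ∣ A ∣ ≡ ∣ B ∣

  Bounded : ∀ {P} → LevelMapping P → Atom → Set
  Bounded {P} ∣_∣ A =
    Finite (λ k → ∃[ A′ ] (atomᵍ {P} A′ InstanceOf A × k ≡ ∣ A′ ∣))

  _⊐_ : Program → Program → Set
  P ⊐ R = ∀ p → DefinedIn p P → ¬ OccursIn p R

  ⋃ : ∀ {n} → (Fin n → Program) → Program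
  ⋃ R = concat (tabulate R)

  -- The union of the programs of index < i.
  ⋃< : ∀ {n} → Fin n → (Fin n → Program) → Program
  ⋃< i R = concat (take (toℕ i) (tabulate R))

  -- Indices start at 0; for i = 0 the union is empty and the condition void.
  Hierarchy : ∀ {n} → (Fin n → Program) → Set
  Hierarchy R = ∀ i → R i ⊐ ⋃< i R

  StronglyBounded : ∀ {n} (R : Fin n → Program) →
                    (∀ i → LevelMapping (R i)) → Query → Set
  StronglyBounded R level Q = ∀ A → Call (⋃ R) Q (pos A) →
    ∀ i → DefinedIn (Atom.rel A) (R i) → Bounded (level i) A

{-# OPTIONS --safe #-}
-- Resolution preserves well-modedness, and so does passing to a subsidiary
-- tree, so every call has ground inputs. All ground instances of such an
-- atom share its inputs, hence a moded level mapping takes exactly one value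
-- on them.
module Submission where

open import Data.Fin using (Fin; zero; suc; toℕ)
open import Data.Nat using (ℕ; _≟_)
open import Defs

open import Data.Empty using (⊥-elim)
open import Data.List using (List; []; _∷_; [_]; _++_; map; concatMap; filter; take; allFin; length; lookup)
open import Data.List.Membership.Propositional using (_∈_)
open import Data.List.Membership.Propositional.Properties using (∈-++⁻)
open import Data.List.Properties
  using (++-assoc; ++-identityʳ; concatMap-++; map-++; map-∘; map-cong)
open import Data.List.Relation.Binary.Subset.Propositional using (_⊆_)
open import Data.List.Relation.Binary.Subset.Propositional.Properties
  using (⊆-reflexive; ++⁺ˡ; xs⊆xs++ys; xs⊆ys++xs; concatMap⁺)
import Data.List.Relation.Unary.All as All
open import Data.List.Relation.Unary.Any as Any using (here; there)
open import Data.Product using (_×_; _,_)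
open import Data.Sum as Sum using (inj₁)
open import Data.Vec as Vec using (Vec; []; _∷_)
open import Function using (_∘_; mk⇔)
open import Relation.Binary.PropositionalEquality
  using (_≡_; refl; sym; trans; cong; cong₂; subst)
open import Relation.Nullary using (yes; no)

module _ (𝓛 : Language) where
  open Language 𝓛
  open LogicPrograms 𝓛

  -- Variables under substitution

  -- The variables of an instance depend only on those of the original, so `θ` acts on variable
  -- lists. As a `concatMap`, this action respects `++` and inclusion, which carries mode conditions
  -- through a substitution.
  instVars : Subst → List Var → List Var
  instVars θ = concatMap (λ x → varsᵗ (θ ⟨ x ⟩))

  varsᵗ-[]  : ∀ θ t → varsᵗ (t [ θ ]ᵗ) ≡ instVars θ (varsᵗ t)
  varsᵗˢ-[] : ∀ θ {n} (ts : Vec Term n) → varsᵗˢ (ts [ θ ]ᵗˢ) ≡ instVars θ (varsᵗˢ ts)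
  varsᵗ-[] θ (var x)    = sym (++-identityʳ _)
  varsᵗ-[] θ (fun f ts) = varsᵗˢ-[] θ ts
  varsᵗˢ-[] θ []        = refl
  varsᵗˢ-[] θ (t ∷ ts)  =
    trans (cong₂ _++_ (varsᵗ-[] θ t) (varsᵗˢ-[] θ ts))
          (sym (concatMap-++ _ (varsᵗ t) (varsᵗˢ ts)))

  fixed-[]ᵗ  : ∀ θ t → (∀ {x} → x ∈ varsᵗ t → θ ⟨ x ⟩ ≡ var x) → t [ θ ]ᵗ ≡ t
  fixed-[]ᵗˢ : ∀ θ {n} (ts : Vec Term n) →
               (∀ {x} → x ∈ varsᵗˢ ts → θ ⟨ x ⟩ ≡ var x) → ts [ θ ]ᵗˢ ≡ ts
  fixed-[]ᵗ θ (var x)    fix = fix (here refl)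
  fixed-[]ᵗ θ (fun f ts) fix = cong (fun f) (fixed-[]ᵗˢ θ ts fix)
  fixed-[]ᵗˢ θ []        fix = refl
  fixed-[]ᵗˢ θ (t ∷ ts)  fix =
    cong₂ _∷_ (fixed-[]ᵗ θ t (fix ∘ xs⊆xs++ys _ _))
              (fixed-[]ᵗˢ θ ts (fix ∘ xs⊆ys++xs _ (varsᵗ t)))

  -- Groundness is expressed as inclusion in `[]`: with no variables present, `θ` has nothing to
  -- replace. Applied to the inputs of a call, this makes all its instances agree on them.
  ground-map-[] : ∀ θ ts → concatMap varsᵗ ts ⊆ [] → map (_[ θ ]ᵗ) ts ≡ ts
  ground-map-[] θ []       g = refl
  ground-map-[] θ (t ∷ ts) g =
    cong₂ _∷_ (fixed-[]ᵗ θ t (absurd ∘ g ∘ xs⊆xs++ys _ _))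
              (ground-map-[] θ ts (g ∘ xs⊆ys++xs _ (varsᵗ t)))
    where
    absurd : ∀ {x} → x ∈ [] → θ ⟨ x ⟩ ≡ var x
    absurd ()

  -- Ground instances built from the constant

  noArgs : Vec Term (funArity constant)
  noArgs = subst (Vec Term) (sym constant-arity) []

  constTerm : Term
  constTerm = fun constant noArgs

  constTerm-ground : varsᵗ constTerm ≡ []
  constTerm-ground = nullary-vars constant-arity noArgs
    where
    -- The arity is generalised to a variable `n` because `funArity constant ≡ 0` cannot be matched
    -- against `refl` directly.
    nullary-vars : ∀ {n} → n ≡ 0 → (ts : Vec Term n) → varsᵗˢ ts ≡ []
    nullary-vars refl [] = refl

  groundingSubst : List Var → Subst
  groundingSubst = map (_, constTerm)

  groundingSubst-∈ : ∀ {x} xs → x ∈ xs → groundingSubst xs ⟨ x ⟩ ≡ constTerm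
  groundingSubst-∈ {x} (y ∷ xs) x∈ with x ≟ y
  ... | yes _ = refl
  groundingSubst-∈ (y ∷ xs) (here x≡y) | no x≢y = ⊥-elim (x≢y x≡y)
  groundingSubst-∈ (y ∷ xs) (there x∈) | no _   = groundingSubst-∈ xs x∈

  -- The list `ys` is kept apart from `xs` so that the induction can shrink it while the
  -- substitution stays fixed.
  groundingSubst-grounds : ∀ xs ys → ys ⊆ xs → instVars (groundingSubst xs) ys ≡ []
  groundingSubst-grounds xs []       ys⊆xs = refl
  groundingSubst-grounds xs (y ∷ ys) ys⊆xs =
    cong₂ _++_ (trans (cong varsᵗ (groundingSubst-∈ xs (ys⊆xs (here refl)))) constTerm-ground)
               (groundingSubst-grounds xs ys (ys⊆xs ∘ there))

  -- `Finite` asks for a list of exactly the attained levels, so some ground instance must exist to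
  -- attain the listed one; the constant of the language supplies it.
  groundInstance : Atom → Atom
  groundInstance A = A [ groundingSubst (varsᵃ A) ]ᵃ

  groundInstance-ground : ∀ A → Ground (groundInstance A)
  groundInstance-ground A =
    trans (varsᵗˢ-[] _ (Atom.args A))
          (groundingSubst-grounds (varsᵃ A) (varsᵃ A) (λ x∈ → x∈))

  -- Moded positions under substitution

  lookup-[] : ∀ θ {n} (ts : Vec Term n) i →
              Vec.lookup (ts [ θ ]ᵗˢ) i ≡ Vec.lookup ts i [ θ ]ᵗ
  lookup-[] θ (t ∷ ts) zero    = refl
  lookup-[] θ (t ∷ ts) (suc i) = lookup-[] θ ts i

  vars-lookup : ∀ {n} (ts : Vec Term n) i → varsᵗ (Vec.lookup ts i) ⊆ varsᵗˢ ts
  vars-lookup (t ∷ ts) zero    = xs⊆xs++ys _ _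
  vars-lookup (t ∷ ts) (suc i) = xs⊆ys++xs _ (varsᵗ t) ∘ vars-lookup ts i

  concatMap-varsᵗ-[] : ∀ θ ts →
    concatMap varsᵗ (map (_[ θ ]ᵗ) ts) ≡ instVars θ (concatMap varsᵗ ts)
  concatMap-varsᵗ-[] θ []       = refl
  concatMap-varsᵗ-[] θ (t ∷ ts) =
    trans (cong₂ _++_ (varsᵗ-[] θ t) (concatMap-varsᵗ-[] θ ts))
          (sym (concatMap-++ _ (varsᵗ t) _))

  atomOf-[] : ∀ θ L → atomOf (L [ θ ]ˡ) ≡ atomOf L [ θ ]ᵃ
  atomOf-[] θ (pos A) = refl
  atomOf-[] θ (neg A) = refl

  module _ (mode : Moding) where

    -- Unfolds to `inVars` or `outVars` according to `d`, so one substitution lemma serves both.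
    varsAt : Mode → Atom → List Var
    varsAt d A = concatMap varsᵗ (termsAt mode d A)

    termsAt-[] : ∀ d θ A → termsAt mode d (A [ θ ]ᵃ) ≡ map (_[ θ ]ᵗ) (termsAt mode d A)
    termsAt-[] d θ (atom p ts) = trans (map-cong (lookup-[] θ ts) _) (map-∘ _)

    varsAt-[] : ∀ d θ A → varsAt d (A [ θ ]ᵃ) ≡ instVars θ (varsAt d A)
    varsAt-[] d θ A =
      trans (cong (concatMap varsᵗ) (termsAt-[] d θ A)) (concatMap-varsᵗ-[] θ (termsAt mode d A))

    varsAt⊆varsᵃ : ∀ d A → varsAt d A ⊆ varsᵃ A
    varsAt⊆varsᵃ d (atom p ts) = positions (filter (λ i → mode p i ≟ᵐ d) (allFin (relArity p)))
      where
      positions : ∀ is → concatMap varsᵗ (map (Vec.lookup ts) is) ⊆ varsᵗˢ ts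
      positions (i ∷ is) x∈ =
        Sum.[ vars-lookup ts i , positions is ] (∈-++⁻ (varsᵗ (Vec.lookup ts i)) x∈)

    outVarsᵠ-[] : ∀ θ Q → outVarsᵠ mode (Q [ θ ]ᵠ) ≡ instVars θ (outVarsᵠ mode Q)
    outVarsᵠ-[] θ []      = refl
    outVarsᵠ-[] θ (L ∷ Q) =
      trans (cong₂ _++_ (trans (cong (outVars mode) (atomOf-[] θ L)) (varsAt-[] output θ (atomOf L)))
                        (outVarsᵠ-[] θ Q))
            (sym (concatMap-++ _ (outVars mode (atomOf L)) _))

    -- Well-modedness as an inductive predicate

    infixr 5 _∷_
    -- V holds the variables already produced: [] for a query, the input
    -- variables of the head for a clause body.
    data WellModedFrom (V : List Var) : Query → Set where
      []  : WellModedFrom V []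
      _∷_ : ∀ {L Q} → inVars mode (atomOf L) ⊆ V →
            WellModedFrom (V ++ outVars mode (atomOf L)) Q → WellModedFrom V (L ∷ Q)

    -- Position 0 has an empty prefix and yields the condition on the first literal; the later
    -- positions yield the tail once the outputs of that literal are moved into `V`.
    wellModedFrom : ∀ V Q →
      (∀ (i : Fin (length Q)) →
        inVars mode (atomOf (lookup Q i)) ⊆ V ++ outVarsᵠ mode (take (toℕ i) Q)) →
      WellModedFrom V Q
    wellModedFrom V []      wm = []
    wellModedFrom V (L ∷ Q) wm =
      (⊆-reflexive (++-identityʳ V) ∘ wm zero) ∷
      wellModedFrom _ Q (λ i → ⊆-reflexive (sym (++-assoc V _ _)) ∘ wm (suc i))

    first-inputsGround : ∀ {L Q} → WellModedFrom [] (L ∷ Q) → inVars mode (atomOf L) ⊆ []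
    first-inputsGround (in⊆ ∷ _) = in⊆

    weaken : ∀ {V W Q} → V ⊆ W → WellModedFrom V Q → WellModedFrom W Q
    weaken V⊆W []         = []
    weaken V⊆W (in⊆ ∷ wm) = (V⊆W ∘ in⊆) ∷ weaken (++⁺ˡ _ V⊆W) wm

    append : ∀ {V B Q} → WellModedFrom V B → WellModedFrom (V ++ outVarsᵠ mode B) Q →
             WellModedFrom V (B ++ Q)
    append     []          wm′ = weaken (⊆-reflexive (++-identityʳ _)) wm′
    append {V} (in⊆ ∷ wm) wm′ =
      in⊆ ∷ append wm (weaken (⊆-reflexive (sym (++-assoc V _ _))) wm′)

    instantiate : ∀ θ {V Q} → WellModedFrom V Q → WellModedFrom (instVars θ V) (Q [ θ ]ᵠ)
    instantiate θ [] = []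
    instantiate θ {V} {L ∷ _} (in⊆ ∷ wm) =
      (concatMap⁺ _ in⊆ ∘ ⊆-reflexive (vars-eq input)) ∷
      weaken (⊆-reflexive (trans (concatMap-++ _ V _)
                                 (cong (instVars θ V ++_) (sym (vars-eq output)))))
             (instantiate θ wm)
      where
      vars-eq : ∀ d → varsAt d (atomOf (L [ θ ]ˡ)) ≡ instVars θ (varsAt d (atomOf L))
      vars-eq d = trans (cong (varsAt d) (atomOf-[] θ L)) (varsAt-[] d θ (atomOf L))

    -- Preservation by resolution

    ClauseModed : Clause → Set
    ClauseModed (H ← B) =
      WellModedFrom (inVars mode H) B × outVars mode H ⊆ inVars mode H ++ outVarsᵠ mode B

    clauseModed-[] : ∀ θ c → ClauseModed c → ClauseModed (c [ θ ]ᶜ)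
    clauseModed-[] θ (H ← B) (wm , out⊆) =
      weaken (⊆-reflexive (sym (varsAt-[] input θ H))) (instantiate θ wm) ,
      ⊆-reflexive (trans (concatMap-++ _ (inVars mode H) _)
                         (sym (cong₂ _++_ (varsAt-[] input θ H) (outVarsᵠ-[] θ B)))) ∘
      concatMap⁺ _ out⊆ ∘
      ⊆-reflexive (varsAt-[] output θ H)

    -- The inputs of `A` are ground and unification makes `H [ θ ]ᵃ` share its inputs with
    -- `A [ θ ]ᵃ`, so the instantiated body can start from no variables at all.
    resolvent-wellModed : ∀ {A H B 𝐋} θ → Unifies θ A H → ClauseModed (H ← B) →
      WellModedFrom [] (pos A ∷ 𝐋) → WellModedFrom [] ((B ++ 𝐋) [ θ ]ᵠ)
    resolvent-wellModed {A} {H} {B} {𝐋} θ unif cm (in⊆ ∷ wm) =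
      let wmB , out⊆ = clauseModed-[] θ (H ← B) cm in
      subst (WellModedFrom []) (sym (map-++ _ B 𝐋))
        (append (weaken inH⊆[] wmB)
                -- Read from right to left: `𝐋` relied on the outputs of `A`, which under `θ` are
                -- those of `H`; the clause condition places them among the head inputs, which are
                -- ground, and the outputs of the body.
                (weaken (++⁺ˡ _ inH⊆[] ∘ out⊆ ∘
                         ⊆-reflexive (trans (sym (varsAt-[] output θ A)) (cong (outVars mode) unif)))
                        (instantiate θ wm)))
      where
      inH⊆[] : inVars mode (H [ θ ]ᵃ) ⊆ []
      inH⊆[] = concatMap⁺ _ in⊆ ∘
               ⊆-reflexive (trans (cong (inVars mode) (sym unif)) (varsAt-[] input θ A))

    module _ (P : Program) (wmP : WellModedProgram mode P) where

      clauseModed : ∀ {c} → c ∈ P → ClauseModed c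
      clauseModed {H ← B} c∈P =
        let body⊆ , out⊆ = All.lookup wmP c∈P in wellModedFrom _ B body⊆ , out⊆

      step-wellModed : ∀ {Q Q′} → Resolvent P Q Q′ → WellModedFrom [] Q → WellModedFrom [] Q′
      step-wellModed (pos {c} c∈P (resolvent H B θ ((ρ , H←B≡cρ) , _) _ (unif , _))) wm =
        resolvent-wellModed θ unif
          -- A variant of `c` is in particular an instance of `c`.
          (subst ClauseModed (sym H←B≡cρ) (clauseModed-[] ρ c (clauseModed c∈P))) wm
      step-wellModed (neg {A} ground _ _) (_ ∷ wm) =
        -- A ground `A` produces no variables, so removing `neg A` takes nothing away from `𝐋`.
        weaken (⊆-reflexive ground ∘ varsAt⊆varsᵃ output A) wm

      descendant-wellModed : ∀ {Q Q′} → Descendant P Q Q′ →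
                             WellModedFrom [] Q → WellModedFrom [] Q′
      descendant-wellModed root       wm = wm
      descendant-wellModed (step r d) wm = descendant-wellModed d (step-wellModed r wm)
      -- Modes ignore the sign, so the condition on `neg A` as first literal is the whole condition
      -- on the query `[ pos A ]`.
      descendant-wellModed (subsidiary _ d) (in⊆ ∷ _) = descendant-wellModed d (in⊆ ∷ [])

      call-inputsGround : ∀ {Q L} → WellModedFrom [] Q → Call P Q L →
                          inVars mode (atomOf L) ⊆ []
      call-inputsGround wm (_ , d) = first-inputsGround (descendant-wellModed d wm)

    -- From ground inputs to boundedness

    inputsGround⇒bounded : ∀ {P} (level : LevelMapping P) → Moded mode level →
      ∀ A → OccursIn (Atom.rel A) P → inVars mode A ⊆ [] → Bounded level A
    inputsGround⇒bounded {P} level moded A occ in⊆ =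
      [ level A₀ ] ,
      -- One direction says every ground instance has the level of `A₀`; the other uses `A₀` itself
      -- as the instance attaining it.
      λ k → mk⇔ (λ { (A′ , inst , k≡) → here (trans k≡ (same-level A′ inst)) })
                (λ { (here k≡) → A₀ , (_ , refl) , k≡ })
      where
      A₀ : GroundAtom P
      A₀ = groundAtom (groundInstance A) (groundInstance-ground A) occ

      inputs-[] : ∀ θ → inputs mode (A [ θ ]ᵃ) ≡ inputs mode A
      inputs-[] θ = trans (termsAt-[] input θ A) (ground-map-[] θ (inputs mode A) in⊆)

      same-level : ∀ A′ → atomᵍ A′ InstanceOf A → level A′ ≡ level A₀
      same-level A′ (θ , A′≡) =
        moded A′ A₀ (cong Atom.rel A′≡)
          (trans (cong (inputs mode) A′≡) (trans (inputs-[] θ) (sym (inputs-[] _))))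

proposition22 : (𝓛 : Language) → let open LogicPrograms 𝓛 in
    (mode : Moding) (n : ℕ) (R : Fin n → Program) →
    WellModedProgram mode (⋃ R) →
    Hierarchy R →
    (level : ∀ i → LevelMapping (R i)) →
    (∀ i → Moded mode (level i)) →
    ∀ Q → WellModedQuery mode Q → StronglyBounded R level Q
proposition22 𝓛 mode n R wmP _ level moded Q wmQ A call i defined =
  inputsGround⇒bounded 𝓛 mode (level i) (moded i) A
    -- A relation heading a clause of `R i` occurs in `R i`, so the ground instances of `A` lie in
    -- the domain of `level i`.
    (Any.map inj₁ defined)
    (call-inputsGround 𝓛 mode (⋃ R) wmP (wellModedFrom 𝓛 mode [] Q wmQ) call)
  where open LogicPrograms 𝓛
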